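{- Let $(G,i)$ be a filter pair over $\Sigma$, $X$ a set and $l=(\Sigma,\vdash^X)$ the associated logic with set of variables $X$. Then for any $\Sigma$-structure $A$, the subsets of $A$ in the image of $i_A$ are $l$-filters.
   Context: $\Sigma$-Str is the category of $\Sigma$-structures and homomorphisms; $Fm(X)$ is the absolutely free $\Sigma$-structure on $X$. $AL$ is the category of algebraic lattices with maps preserving arbitrary meets and directed joins. A filter pair over $\Sigma$ is a pair $(G,i)$ of a contravariant functor $G:\Sigma\text{ -Str}\to AL$ and maps $i_A:G(A)\to(\mathcal{P}(A),\subseteq)$, one for each $\Sigma$-structure $A$, preserving arbitrary infima (in particular $i_A(\top)=A$) and directed suprema, such that $i_A\circ G(h)=h^{ -1}\circ i_B$ for every homomorphism $h:A\to B$. The associated logic $(\Sigma,\vdash^X)$: for $\Gamma\cup\{\varphi\}\subseteq Fm(X)$, $\Gamma\vdash^X\varphi$ iff for every $a\in G(Fm(X))$, $\Gamma\subseteq i_{Fm(X)}(a)$ implies $\varphi\in i_{Fm(X)}(a)$. An $l$-filter on $A$ is a subset $F\subseteq A$ such that whenever $\Gamma\vdash^X\varphi$ and $v:Fm(X)\to A$ is a homomorphism with $v[\Gamma]\subseteq F$, then $v(\varphi)\in F$. -}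

module Defs where

open import Level using (Level; suc; _⊔_)
open import Data.Nat.Base using (ℕ)
open import Data.Product.Base using (Σ-syntax; ∃-syntax; _×_; proj₁)
open import Data.Vec.Base using (Vec; map)
open import Data.Vec.Properties using (map-id; map-∘)
open import Function.Base using (_∘_; id)
open import Relation.Binary.Bundles using (Poset)
open import Relation.Binary.Morphism.Bundles using (PosetHomomorphism)
open import Relation.Binary.PropositionalEquality
  using (_≡_; _≗_; refl; sym; trans; cong)
open import Relation.Unary using (Pred; _∈_; _⊆_; _≐_; ⋂; ⋃; _⊢_)
open import Relation.Unary.Relation.Binary.Subset using (⊆-poset)

-- Sets are types with propositional equality; signatures, structures and sets
-- of variables all live in one universe Set ℓ.

record Signature (ℓ : Level) : Set (suc ℓ) where
  field
    Op : ℕ → Set ℓ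

record Structure {ℓ : Level} (𝕊 : Signature ℓ) : Set (suc ℓ) where
  open Signature 𝕊
  field
    Carrier : Set ℓ
    ⟦_⟧ᵒ    : {n : ℕ} → Op n → Vec Carrier n → Carrier

module _ {ℓ : Level} {𝕊 : Signature ℓ} where

  open Signature 𝕊
  open Structure

  record Hom (A B : Structure 𝕊) : Set ℓ where
    field
      fun  : Carrier A → Carrier B
      homo : {n : ℕ} (f : Op n) (xs : Vec (Carrier A) n) →
             fun (⟦_⟧ᵒ A f xs) ≡ ⟦_⟧ᵒ B f (map fun xs)

  open Hom

  idHom : (A : Structure 𝕊) → Hom A A
  idHom A = record
    { fun  = id
    ; homo = λ f xs → cong (⟦_⟧ᵒ A f) (sym (map-id xs))
    }

  infixr 9 _∘ʰ_

  _∘ʰ_ : {A B C : Structure 𝕊} → Hom B C → Hom A B → Hom A C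
  _∘ʰ_ {C = C} g h = record
    { fun  = fun g ∘ fun h
    ; homo = λ f xs →
        trans (cong (fun g) (homo h f xs))
        (trans (homo g f (map (fun h) xs))
               (cong (⟦_⟧ᵒ C f) (sym (map-∘ (fun g) (fun h) xs))))
    }

data Term {ℓ : Level} (𝕊 : Signature ℓ) (X : Set ℓ) : Set ℓ where
  var : X → Term 𝕊 X
  app : {n : ℕ} → Signature.Op 𝕊 n → Vec (Term 𝕊 X) n → Term 𝕊 X

Fm : {ℓ : Level} (𝕊 : Signature ℓ) → Set ℓ → Structure 𝕊
Fm 𝕊 X = record { Carrier = Term 𝕊 X ; ⟦_⟧ᵒ = app }

-- Subsets of a lattice are given as families indexed by
-- types in Set ι.  The level ι is independent of that of the carrier: taking it
-- large enough gives all subsets, taking it smaller gives the predicative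
-- notion of a large lattice with small infima and suprema.

module _ {c ℓ₁ ℓ₂ : Level} (P : Poset c ℓ₁ ℓ₂) where

  open Poset P

  IsInfimum : {i : Level} {I : Set i} → (I → Carrier) → Carrier → Set (c ⊔ ℓ₂ ⊔ i)
  IsInfimum d x = (∀ j → x ≤ d j) × (∀ y → (∀ j → y ≤ d j) → y ≤ x)

  IsSupremum : {i : Level} {I : Set i} → (I → Carrier) → Carrier → Set (c ⊔ ℓ₂ ⊔ i)
  IsSupremum d x = (∀ j → d j ≤ x) × (∀ y → (∀ j → d j ≤ y) → x ≤ y)

  -- Directed families are inhabited.
  Directed : {i : Level} {I : Set i} → (I → Carrier) → Set (ℓ₂ ⊔ i)
  Directed {I = I} d = I × (∀ j k → ∃[ m ] (d j ≤ d m × d k ≤ d m))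

  Compact : (ι : Level) → Carrier → Set (c ⊔ ℓ₂ ⊔ suc ι)
  Compact ι k = {I : Set ι} (d : I → Carrier) → Directed d →
                (s : Carrier) → IsSupremum d s → k ≤ s → ∃[ j ] k ≤ d j

record AlgebraicLattice (c ℓ₁ ℓ₂ ι : Level) : Set (suc (c ⊔ ℓ₁ ⊔ ℓ₂ ⊔ ι)) where
  field
    poset : Poset c ℓ₁ ℓ₂

  open Poset poset public

  field
    ⋀          : {I : Set ι} → (I → Carrier) → Carrier
    ⋁          : {I : Set ι} → (I → Carrier) → Carrier
    ⋀-infimum  : {I : Set ι} (d : I → Carrier) → IsInfimum poset d (⋀ d)
    ⋁-supremum : {I : Set ι} (d : I → Carrier) → IsSupremum poset d (⋁ d)
    algebraic  : (x : Carrier) →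
                 IsSupremum poset
                   {I = Σ[ k ∈ Carrier ] (Compact poset ι k × k ≤ x)} proj₁ x

module _ {c ℓ₁ ℓ₂ ι : Level} where

  record ALHom (L M : AlgebraicLattice c ℓ₁ ℓ₂ ι) : Set (c ⊔ ℓ₁ ⊔ ℓ₂ ⊔ suc ι) where
    private
      module L = AlgebraicLattice L
      module M = AlgebraicLattice M
    field
      homomorphism : PosetHomomorphism L.poset M.poset

    open PosetHomomorphism homomorphism public using (⟦_⟧)

    field
      ⋀-homo : {I : Set ι} (d : I → L.Carrier) →
               ⟦ L.⋀ d ⟧ M.≈ M.⋀ (⟦_⟧ ∘ d)
      ⋁-homo : {I : Set ι} (d : I → L.Carrier) → Directed L.poset d →
               ⟦ L.⋁ d ⟧ M.≈ M.⋁ (⟦_⟧ ∘ d)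

  -- Infima and suprema in the powerset are intersections and unions.
  record PowersetHom (L : AlgebraicLattice c ℓ₁ ℓ₂ ι) {ℓ : Level} (A : Set ℓ) (p : Level) :
                     Set (c ⊔ ℓ₁ ⊔ ℓ₂ ⊔ suc ι ⊔ ℓ ⊔ suc p) where
    private
      module L = AlgebraicLattice L
    field
      homomorphism : PosetHomomorphism L.poset (⊆-poset A p)

    open PosetHomomorphism homomorphism public using (⟦_⟧)

    field
      ⋀-homo : {I : Set ι} (d : I → L.Carrier) →
               ⟦ L.⋀ d ⟧ ≐ ⋂ I (⟦_⟧ ∘ d)
      ⋁-homo : {I : Set ι} (d : I → L.Carrier) → Directed L.poset d →
               ⟦ L.⋁ d ⟧ ≐ ⋃ I (⟦_⟧ ∘ d)

-- Parallel homomorphisms are equal when they agree pointwise, hence the field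
-- G-resp.

record ContravariantFunctor {ℓ : Level} (𝕊 : Signature ℓ) (c ℓ₁ ℓ₂ ι : Level) :
                            Set (suc (ℓ ⊔ c ⊔ ℓ₁ ⊔ ℓ₂ ⊔ ι)) where
  field
    G₀ : Structure 𝕊 → AlgebraicLattice c ℓ₁ ℓ₂ ι
    G₁ : {A B : Structure 𝕊} → Hom A B → ALHom (G₀ B) (G₀ A)

  module G₀ (A : Structure 𝕊) = AlgebraicLattice (G₀ A)

  apply : {A B : Structure 𝕊} → Hom A B → G₀.Carrier B → G₀.Carrier A
  apply h = ALHom.⟦_⟧ (G₁ h)

  field
    G-resp : {A B : Structure 𝕊} {g h : Hom A B} → Hom.fun g ≗ Hom.fun h →
             (b : G₀.Carrier B) → G₀._≈_ A (apply g b) (apply h b)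
    G-id   : {A : Structure 𝕊} (a : G₀.Carrier A) →
             G₀._≈_ A (apply (idHom A) a) a
    G-∘    : {A B C : Structure 𝕊} (g : Hom B C) (h : Hom A B) (x : G₀.Carrier C) →
             G₀._≈_ A (apply (g ∘ʰ h) x) (apply h (apply g x))

record FilterPair {ℓ : Level} (𝕊 : Signature ℓ) (c ℓ₁ ℓ₂ ι p : Level) :
                  Set (suc (ℓ ⊔ c ⊔ ℓ₁ ⊔ ℓ₂ ⊔ ι ⊔ p)) where
  field
    G : ContravariantFunctor 𝕊 c ℓ₁ ℓ₂ ι

  open ContravariantFunctor G public

  field
    iHom : (A : Structure 𝕊) → PowersetHom (G₀ A) (Structure.Carrier A) p

  i : (A : Structure 𝕊) → G₀.Carrier A → Pred (Structure.Carrier A) p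
  i A = PowersetHom.⟦_⟧ (iHom A)

  field
    natural : {A B : Structure 𝕊} (h : Hom A B) (b : G₀.Carrier B) →
              i A (apply h b) ≐ (Hom.fun h ⊢ i B b)

module _ {ℓ c ℓ₁ ℓ₂ ι p : Level} {𝕊 : Signature ℓ} where

  -- The consequence relation of the logic associated with a filter pair.
  Entails : FilterPair 𝕊 c ℓ₁ ℓ₂ ι p → (X : Set ℓ) →
            Pred (Term 𝕊 X) p → Term 𝕊 X → Set (ℓ ⊔ c ⊔ p)
  Entails GI X Γ φ = (a : G₀.Carrier (Fm 𝕊 X)) →
                     Γ ⊆ i (Fm 𝕊 X) a → φ ∈ i (Fm 𝕊 X) a
    where open FilterPair GI

IsFilter : {ℓ p r q : Level} {𝕊 : Signature ℓ} {X : Set ℓ} →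
           (Pred (Term 𝕊 X) p → Term 𝕊 X → Set r) →
           (A : Structure 𝕊) → Pred (Structure.Carrier A) q → Set (ℓ ⊔ suc p ⊔ r ⊔ q)
IsFilter {p = p} {𝕊 = 𝕊} {X = X} _⊢ˣ_ A F =
  (Γ : Pred (Term 𝕊 X) p) (φ : Term 𝕊 X) → Γ ⊢ˣ φ →
  (v : Hom (Fm 𝕊 X) A) → (∀ ψ → ψ ∈ Γ → Hom.fun v ψ ∈ F) → Hom.fun v φ ∈ F

{-# OPTIONS --safe #-}
module Submission where

open import Defs
open import Level using (Level)
open import Data.Product.Base using (∃-syntax; _,_; proj₁; proj₂)
open import Relation.Unary using (Pred; _≐_)

-- For i a = F, naturality of i at v identifies v⁻¹ F with i (G v a), one of the
-- sets that the consequence relation quantifies over.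
proposition2p10 : {ℓ c ℓ₁ ℓ₂ ι p : Level} {𝕊 : Signature ℓ}
    (GI : FilterPair 𝕊 c ℓ₁ ℓ₂ ι p) (X : Set ℓ)
    (A : Structure 𝕊) (F : Pred (Structure.Carrier A) p) →
    (∃[ a ] (FilterPair.i GI A a ≐ F)) → IsFilter (Entails GI X) A F
proposition2p10 GI X A F (a , ia⊆F , F⊆ia) Γ φ Γ⊢φ v vΓ⊆F =
  -- The entailment is tested at the single element `apply v a`. It places `φ` in the preimage of
  -- `i A a` under `v`, and `i A a` is contained in `F`.
  ia⊆F (proj₁ (natural v a) (Γ⊢φ (apply v a) λ {ψ} ψ∈Γ →
    -- The reverse inclusions supply the premise of the entailment: `v` sends `ψ` into `F`, hence
    -- into `i A a`, so `ψ` lies in `i (Fm 𝕊 X) (apply v a)`.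
    proj₂ (natural v a) (F⊆ia (vΓ⊆F ψ ψ∈Γ))))
  where open FilterPair GI
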